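{- Let $G$ be a connected chordal graph and let $C$ be a maximal clique of $G$. There exists a clique tree of $G$ of which $C$ is an endpoint if and only if $C$ is simply separated.
   Context: Graphs are finite, simple and undirected. Maximal cliques are regarded as subsets of the vertex set $V$; $\mathcal C$ is the set of all maximal cliques of $G$. A vertex $v$ is simplicial if its set of neighbors is a clique. For $C\in\mathcal C$, $\mathrm{Simp}(C)$ is the set of simplicial vertices of $G$ lying in $C$ and $\mathrm{Sep}(C)=C\setminus\mathrm{Simp}(C)$. A maximal clique $C$ with $\mathrm{Simp}(C)\ne\emptyset$ is called simply separated (or a boundary clique) if there exists a maximal clique $C'\in\mathcal C$ with $\mathrm{Sep}(C)=C\cap C'$. A clique tree of $G$ is a tree $T=(\mathcal C,\mathcal E)$ with node set $\mathcal C$ such that for all $C_1,C_2\in\mathcal C$ and every $C_3\in\mathcal C$ on the unique path in $T$ between $C_1$ and $C_2$, $C_1\cap C_2\subseteq C_3$. An endpoint of a tree is a node of degree $1$ (a leaf). -}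

module Defs where

open import Data.Fin.Base using (Fin; toℕ)
open import Data.Fin.Subset using (Subset; _∈_; _⊆_; _∩_)
open import Data.List.Base using (List; []; _∷_)
import Data.List.Membership.Propositional as List
open import Data.List.Relation.Unary.Unique.Propositional using (Unique)
open import Data.Nat.Base using (ℕ; suc; _≤_)
open import Data.Product using (_×_; ∃; ∃₂; ∃!)
open import Data.Refinement using (Refinement-syntax; value)
open import Data.Sum.Base using (_⊎_)
open import Function.Definitions using (Injective)
open import Level using (0ℓ)
open import Relation.Binary.Construct.Closure.ReflexiveTransitive using (Star; ε; _◅_)
open import Relation.Binary.Core using (Rel)
open import Relation.Binary.Definitions using (Decidable; Irreflexive; Symmetric)
open import Relation.Binary.PropositionalEquality.Core using (_≡_; _≢_)
open import Relation.Nullary.Negation.Core using (¬_)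
open import Relation.Unary using (Pred; Satisfiable; _≐_; _∖_)

-- Vertex types are finite wherever this record is used: Fin n, or the set of
-- maximal cliques of a graph on Fin n.  Decidability of adjacency is the
-- constructive content of "finite graph"; classically it is no restriction.
record SimpleGraph (V : Set) : Set₁ where
  field
    Adj    : Rel V 0ℓ
    adj?   : Decidable Adj
    sym    : Symmetric Adj
    irrefl : Irreflexive _≡_ Adj

-- j is the successor of i in the cyclic order 0, 1, …, k - 1, 0.
CyclicSuc : ∀ {k} → Rel (Fin k) 0ℓ
CyclicSuc {k} i j = (suc (toℕ i) ≡ toℕ j) ⊎ (suc (toℕ i) ≡ k × toℕ j ≡ 0)

module _ {V : Set} (G : SimpleGraph V) where
  open SimpleGraph G

  Walk : Rel V 0ℓ
  Walk = Star Adj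

  vertices : ∀ {u v} → Walk u v → List V
  vertices (ε {u})       = u ∷ []
  vertices (_◅_ {u} _ w) = u ∷ vertices w

  IsPath : ∀ {u v} → Walk u v → Set
  IsPath w = Unique (vertices w)

  Connected : Set
  Connected = ∀ u v → Walk u v

  record Cycle (k : ℕ) : Set where
    field
      3≤k       : 3 ≤ k
      vertex    : Fin k → V
      injective : Injective _≡_ _≡_ vertex
      adjacent  : ∀ {i j} → CyclicSuc i j → Adj (vertex i) (vertex j)

  HasChord : ∀ {k} → Cycle k → Set
  HasChord c = ∃₂ λ i j → ¬ CyclicSuc i j × ¬ CyclicSuc j i × Adj (vertex i) (vertex j)
    where open Cycle c

  Chordal : Set
  Chordal = ∀ {k} → 4 ≤ k → (c : Cycle k) → HasChord c

  Acyclic : Set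
  Acyclic = ∀ {k} → ¬ Cycle k

  IsTree : Set
  IsTree = Connected × Acyclic

  -- A leaf: a vertex of degree exactly one, so not the vertex of a one-vertex tree.
  Endpoint : Pred V 0ℓ
  Endpoint v = ∃! _≡_ (Adj v)

  IsClique : Pred V 0ℓ → Set
  IsClique P = ∀ {u v} → P u → P v → u ≢ v → Adj u v

  Simplicial : Pred V 0ℓ
  Simplicial v = IsClique (Adj v)

module _ {n : ℕ} (G : SimpleGraph (Fin n)) where

  IsMaximalClique : Subset n → Set
  IsMaximalClique S =
    IsClique G (_∈ S) × (∀ {S′} → IsClique G (_∈ S′) → S ⊆ S′ → S ≡ S′)

  -- Irrelevance of the maximality proof makes equality of maximal cliques
  -- equality of vertex sets.  Maximality is decidable, so the proof can be
  -- recomputed when needed.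
  MaximalClique : Set
  MaximalClique = [ S ∈ Subset n ∣ IsMaximalClique S ]

  Simp : MaximalClique → Pred (Fin n) 0ℓ
  Simp C v = v ∈ value C × Simplicial G v

  Sep : MaximalClique → Pred (Fin n) 0ℓ
  Sep C = (_∈ value C) ∖ Simp C

  SimplySeparated : Pred MaximalClique 0ℓ
  SimplySeparated C =
    Satisfiable (Simp C) × ∃ λ (C′ : MaximalClique) → Sep C ≐ (_∈ value C ∩ value C′)

  -- IsPath p makes p the unique path in T between its two ends.
  IsCliqueTree : SimpleGraph MaximalClique → Set
  IsCliqueTree T = IsTree T ×
    (∀ {C₁ C₂} (p : Walk T C₁ C₂) → IsPath T p →
     ∀ {C₃} → C₃ List.∈ vertices T p → value C₁ ∩ value C₂ ⊆ value C₃)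

{-# OPTIONS --safe #-}
module Submission where

open import Defs
import Data.Bool.Properties as Bool
open import Data.Empty using (⊥; ⊥-elim)
open import Data.Fin.Base using (Fin; zero; suc; toℕ; fromℕ; fromℕ<; inject₁)
open import Data.Fin.Properties using (_≟_; any?; all?; toℕ<n; toℕ-fromℕ; toℕ-fromℕ<; toℕ-inject₁)
open import Data.Fin.Subset using (Subset; _∈_; _∉_; _⊆_; _⊂_; _∩_; _∪_; _-_; ⁅_⁆; Nonempty)
  renaming (⊤ to full)
open import Data.Fin.Subset.Induction using (Acc; acc; ⊂-wellFounded; ⊃-wellFounded)
open import Data.Fin.Subset.Properties
import Data.Irrelevant as Irrelevant
open import Data.List.Base using (List; []; _∷_; _∷ʳ_; lookup; length; map)
import Data.List.Membership.Propositional as List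
open import Data.List.Membership.Propositional.Properties using (∈-map⁺; ∈-map⁻; ∈-lookup)
open import Data.List.Relation.Unary.All as All using (All; []; _∷_)
open import Data.List.Relation.Unary.All.Properties using (¬Any⇒All¬; ++⁺; ++⁻ˡ)
open import Data.List.Relation.Unary.AllPairs.Core using ([]; _∷_)
open import Data.List.Relation.Unary.Any using (here; there)
open import Data.List.Relation.Unary.Unique.Propositional using (Unique)
import Data.List.Relation.Unary.Unique.Propositional.Properties as Unique
open import Data.Nat.Base using (ℕ; suc; _≤_; z≤n; s≤s)
open import Data.Nat.Properties using (suc-injective; _<?_; ≤-antisym; ≮⇒≥; m≤n⇒m≤1+n)
open import Data.Product.Base using (_×_; _,_; ∃; ∃₂; proj₁; proj₂)
open import Data.Refinement as Refinement using (_,_; value; value-injective)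
open import Data.Sum.Base using (_⊎_; inj₁; inj₂; [_,_]′)
open import Data.Vec.Base using (tabulate)
open import Data.Vec.Properties using (≡-dec; lookup⇒[]=; []=⇒lookup; lookup∘tabulate)
open import Function.Base using (_∘_; id; flip)
open import Function.Bundles using (_⇔_; mk⇔)
open import Function.Definitions using (Injective)
open import Level using (0ℓ)
open import Relation.Binary.Construct.Closure.ReflexiveTransitive as Star using (Star; ε; _◅_; _◅◅_)
open import Relation.Binary.Core using (Rel)
open import Relation.Binary.Definitions using (DecidableEquality)
open import Relation.Binary.PropositionalEquality.Core
  using (_≡_; _≢_; refl; sym; trans; cong; subst; ≢-sym)
open import Relation.Nullary.Decidable
  using (Dec; yes; no; does; map′; dec-true; ¬?; _×-dec_; _⊎-dec_; _→-dec_;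
         decidable-stable; recompute)
open import Relation.Nullary.Negation using (¬_; contradiction)
open import Relation.Unary using (Pred; Decidable)

-- A leaf C of a clique tree has its tree neighbour as separator: a vertex of C
-- with a neighbour outside C lies in another maximal clique D, and the tree path
-- from C to D enters through that neighbour.
--
-- Conversely, let C be simply separated by C′.  The maximal cliques of
-- G ∖ Simp C are those of G other than C, so it suffices to build a clique tree
-- of that chordal graph and hang C on C′.  Clique trees are built as orders with
-- the running intersection property, by removing simplicial vertices one at a
-- time: if K is the neighbourhood of the removed vertex v, then K ∪ {v} either
-- replaces K or is hung on a maximal clique strictly containing K.  Simplicial
-- vertices come from Dirac's lemma.

-- Finite sets

module _ {n : ℕ} where

  infix 4 _≟ₛ_
  _≟ₛ_ : DecidableEquality (Subset n)
  _≟ₛ_ = ≡-dec Bool._≟_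

  abstract
    ⟦_⟧ : {P : Pred (Fin n) 0ℓ} → Decidable P → Subset n
    ⟦ P? ⟧ = tabulate (does ∘ P?)

    ∈-⟦⟧⁺ : {P : Pred (Fin n) 0ℓ} (P? : Decidable P) → ∀ {x} → P x → x ∈ ⟦ P? ⟧
    ∈-⟦⟧⁺ P? {x} px = lookup⇒[]= x _ (trans (lookup∘tabulate _ x) (dec-true (P? x) px))

    ∈-⟦⟧⁻ : {P : Pred (Fin n) 0ℓ} (P? : Decidable P) → ∀ {x} → x ∈ ⟦ P? ⟧ → P x
    ∈-⟦⟧⁻ P? {x} x∈ with P? x | trans (sym (lookup∘tabulate (does ∘ P?) x)) ([]=⇒lookup x∈)
    ... | yes px | _ = px
    ... | no _   | ()

  x∉p-x : ∀ {p : Subset n} {x} → x ∉ p - x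
  x∉p-x {p} {x} x∈ with x∈p⇒p-x⊂p (p─q⊆p p ⁅ x ⁆ x∈)
  ... | _ , y , y∈p , y∉ with y ≟ x
  ...   | yes refl = y∉ x∈
  ...   | no y≢x   = y∉ (x∈p∧x≢y⇒x∈p-y y∈p y≢x)

  ∈-∪⁅⁆⁻ : ∀ {p : Subset n} {x y} → x ∈ p ∪ ⁅ y ⁆ → x ∈ p ⊎ x ≡ y
  ∈-∪⁅⁆⁻ {p} {y = y} x∈ with x∈p∪q⁻ p ⁅ y ⁆ x∈
  ... | inj₁ x∈p = inj₁ x∈p
  ... | inj₂ x∈y = inj₂ (x∈⁅y⁆⇒x≡y y x∈y)

  y∈p∪⁅y⁆ : ∀ {p : Subset n} {y} → y ∈ p ∪ ⁅ y ⁆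
  y∈p∪⁅y⁆ {p} {y} = q⊆p∪q p ⁅ y ⁆ (x∈⁅x⁆ y)

  -- Greedy growth terminates because a subset of a finite set can gain points only finitely often.
  -- It yields components as well as maximal cliques.
  saturate : (I D : Pred (Subset n) 0ℓ) →
    (∀ {K} → I K → D K ⊎ ∃ λ w → w ∉ K × I (K ∪ ⁅ w ⁆)) →
    ∀ {K} → I K → ∃ λ M → I M × D M
  saturate I D step {K} = go (⊃-wellFounded K)
    where
    go : ∀ {K} → Acc (flip _⊂_) K → I K → ∃ λ M → I M × D M
    go {K} (acc rec) iK with step iK
    ... | inj₁ dK = K , iK , dK
    ... | inj₂ (w , w∉K , iK′) =
      go (rec (p⊆p∪q ⁅ w ⁆ , w , y∈p∪⁅y⁆ {p = K} , w∉K)) iK′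

-- Walks and induced paths

module _ {V : Set} (G : SimpleGraph V) where
  open SimpleGraph G renaming (sym to Adj-sym)

  start∈vertices : ∀ {u v} (w : Walk G u v) → u List.∈ vertices G w
  start∈vertices ε       = here refl
  start∈vertices (_ ◅ _) = here refl

  end∈vertices : ∀ {u v} (w : Walk G u v) → v List.∈ vertices G w
  end∈vertices ε       = here refl
  end∈vertices (_ ◅ w) = there (end∈vertices w)

  module _ (_≟ᵥ_ : DecidableEquality V) where
    open import Data.List.Membership.DecPropositional _≟ᵥ_ using () renaming (_∈?_ to _∈ₗ?_)

    suffix : ∀ {u v x} (w : Walk G u v) → IsPath G w → x List.∈ vertices G w →
      ∃ λ (p : Walk G x v) → IsPath G p
    suffix ε       uw       (here refl) = ε , uw
    suffix (e ◅ w) uw       (here refl) = e ◅ w , uw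
    suffix (_ ◅ w) (_ ∷ uw) (there x∈)  = suffix w uw x∈

    loopErase : ∀ {u v} → Walk G u v → ∃ λ (p : Walk G u v) → IsPath G p
    loopErase ε = ε , [] ∷ []
    loopErase {u} (e ◅ w) with loopErase w
    ... | p , up with u ∈ₗ? vertices G p
    ...   | yes u∈ = suffix p up u∈
    ...   | no u∉  = e ◅ p , ¬Any⇒All¬ _ u∉ ∷ up

  Apart : V → V → Set
  Apart x y = x ≢ y × ¬ Adj x y

  -- Apartness is imposed from the second successor on, so a vertex is adjacent to no later one but
  -- the next. Chordlessness and injectivity are thus built in.
  data InducedPath : V → V → List V → Set where
    [_] : ∀ x → InducedPath x x (x ∷ [])
    _∷⟨_⟩_ : ∀ {x y z zs} → Adj x y → All (Apart x) zs →
      InducedPath y z (y ∷ zs) → InducedPath x z (x ∷ y ∷ zs)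

  adj⇒≢ : ∀ {x y} → Adj x y → x ≢ y
  adj⇒≢ e refl = irrefl refl e

  first-index : ∀ {a b xs} → InducedPath a b xs →
    ∃ λ (i : Fin (length xs)) → toℕ i ≡ 0 × lookup xs i ≡ a
  first-index [ _ ]        = zero , refl , refl
  first-index (_ ∷⟨ _ ⟩ _) = zero , refl , refl

  last-index : ∀ {a b xs} → InducedPath a b xs →
    ∃ λ (i : Fin (length xs)) → suc (toℕ i) ≡ length xs × lookup xs i ≡ b
  last-index [ _ ] = zero , refl , refl
  last-index (_ ∷⟨ _ ⟩ p) with last-index p
  ... | i , i≡l , at = suc i , cong suc i≡l , at

  induced-first : ∀ {a b xs} → InducedPath a b xs → (i : Fin (length xs)) →
    toℕ i ≡ 0 → lookup xs i ≡ a
  induced-first [ _ ]        zero _ = refl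
  induced-first (_ ∷⟨ _ ⟩ _) zero _ = refl

  induced-last : ∀ {a b xs} → InducedPath a b xs → (i : Fin (length xs)) →
    suc (toℕ i) ≡ length xs → lookup xs i ≡ b
  induced-last [ _ ]        zero    _  = refl
  induced-last (_ ∷⟨ _ ⟩ p) (suc i) eq = induced-last p i (suc-injective eq)

  induced-adjacent : ∀ {a b xs} → InducedPath a b xs → (i j : Fin (length xs)) →
    suc (toℕ i) ≡ toℕ j → Adj (lookup xs i) (lookup xs j)
  induced-adjacent [ _ ]        _       zero          ()
  induced-adjacent (e ∷⟨ _ ⟩ _) zero    (suc zero)    _  = e
  induced-adjacent (_ ∷⟨ _ ⟩ p) (suc i) (suc j)       eq = induced-adjacent p i j (suc-injective eq)

  -- Equality and adjacency are treated at once because `Apart` excludes both; the first yields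
  -- injectivity, the second the absence of chords.
  induced-chordless : ∀ {a b xs} → InducedPath a b xs → (i j : Fin (length xs)) →
    lookup xs i ≡ lookup xs j ⊎ Adj (lookup xs i) (lookup xs j) →
    i ≡ j ⊎ suc (toℕ i) ≡ toℕ j ⊎ suc (toℕ j) ≡ toℕ i
  induced-chordless [ _ ] zero zero _ = inj₁ refl
  induced-chordless (_ ∷⟨ _ ⟩ _) zero zero _ = inj₁ refl
  induced-chordless (_ ∷⟨ _ ⟩ _) zero (suc zero) _ = inj₂ (inj₁ refl)
  induced-chordless (_ ∷⟨ _ ⟩ _) (suc zero) zero _ = inj₂ (inj₂ refl)
  induced-chordless (_ ∷⟨ ap ⟩ _) zero (suc (suc j)) r =
    contradiction r [ proj₁ (All.lookup ap (∈-lookup j)) , proj₂ (All.lookup ap (∈-lookup j)) ]′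
  induced-chordless (_ ∷⟨ ap ⟩ _) (suc (suc i)) zero r =
    contradiction r [ proj₁ (All.lookup ap (∈-lookup i)) ∘ sym
                    , proj₂ (All.lookup ap (∈-lookup i)) ∘ Adj-sym ]′
  induced-chordless (_ ∷⟨ _ ⟩ p) (suc i) (suc j) r with induced-chordless p i j r
  ... | inj₁ i≡j        = inj₁ (cong suc i≡j)
  ... | inj₂ (inj₁ eq)  = inj₂ (inj₁ (cong suc eq))
  ... | inj₂ (inj₂ eq)  = inj₂ (inj₂ (cong suc eq))

  induced-injective : ∀ {a b xs} → InducedPath a b xs → Injective _≡_ _≡_ (lookup xs)
  induced-injective p {i} {j} eq with induced-chordless p i j (inj₁ eq)
  ... | inj₁ i≡j       = i≡j
  ... | inj₂ (inj₁ s)  = contradiction eq (adj⇒≢ (induced-adjacent p i j s))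
  ... | inj₂ (inj₂ s)  = contradiction (sym eq) (adj⇒≢ (induced-adjacent p j i s))

  module _ (_≟ᵥ_ : DecidableEquality V) where

    -- The tail is tried first, so `x` is joined at the vertex nearest to `z` that it equals or is
    -- adjacent to. Everything beyond is apart from `x`, which keeps the path induced.
    extend : ∀ x {y z xs} → InducedPath y z xs →
      (∃ λ ys → InducedPath x z ys × All (List._∈ x ∷ xs) ys) ⊎ All (Apart x) xs
    extend x {z = z} [ _ ] with x ≟ᵥ z | adj? x z
    ... | yes refl | _     = inj₁ (_ , [ z ] , here refl ∷ [])
    ... | no _     | yes e = inj₁ (_ , e ∷⟨ [] ⟩ [ z ] , here refl ∷ there (here refl) ∷ [])
    ... | no x≢z   | no ¬e = inj₂ ((x≢z , ¬e) ∷ [])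
    extend x {y} (e₀ ∷⟨ ap ⟩ p) with extend x p
    ... | inj₁ (ys , q , ys⊆) =
      inj₁ (ys , q , All.map (λ { (here eq) → here eq ; (there v∈) → there (there v∈) }) ys⊆)
    ... | inj₂ far with x ≟ᵥ y | adj? x y
    ...   | yes refl | _     = inj₁ (_ , e₀ ∷⟨ ap ⟩ p , All.tabulate there)
    ...   | no _     | yes e = inj₁ (_ , e ∷⟨ far ⟩ (e₀ ∷⟨ ap ⟩ p) , All.tabulate id)
    ...   | no x≢y   | no ¬e = inj₂ ((x≢y , ¬e) ∷ far)

    prepend : ∀ {Q : Pred V 0ℓ} {x y z xs} → Adj x y → Q x → InducedPath y z xs → All Q xs →
      ∃ λ ys → InducedPath x z ys × All Q ys
    prepend {x = x} e qx p qs with extend x p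
    ... | inj₁ (ys , q , ys⊆) = ys , q , All.map (All.lookup (qx ∷ qs)) ys⊆
    ... | inj₂ far = contradiction e (proj₂ (start-apart p far))
      where
      start-apart : ∀ {x y z xs} → InducedPath y z xs → All (Apart x) xs → Apart x y
      start-apart [ _ ]        (ap ∷ _) = ap
      start-apart (_ ∷⟨ _ ⟩ _) (ap ∷ _) = ap

    -- The walk is short-cut from its end backwards. A step records `Q` only at its source, so `y`
    -- and `z` bring their own proofs.
    inducedPath : ∀ {Q : Pred V 0ℓ} {x y z} →
      Star (λ u v → Adj u v × Q u) x y → Adj y z → Q y → Q z →
      ∃ λ ys → InducedPath x z ys × All Q ys
    inducedPath ε e qy qz = prepend e qy [ _ ] (qz ∷ [])
    inducedPath ((e₀ , qx) ◅ w) e qy qz with inducedPath w e qy qz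
    ... | _ , p , qs = prepend e₀ qx p qs

  induced-length : ∀ {a b xs} → InducedPath a b xs → Apart a b → 3 ≤ length xs
  induced-length [ _ ] (a≢b , _) = contradiction refl a≢b
  induced-length (e ∷⟨ _ ⟩ [ _ ]) (_ , ¬e) = contradiction e ¬e
  induced-length (_ ∷⟨ _ ⟩ (_ ∷⟨ _ ⟩ _)) _ = s≤s (s≤s (s≤s z≤n))

  -- Closing the path through v gives a cycle of length at least 4 with no chord.
  no-induced-detour : Chordal G → ∀ {v a b xs} → Adj v a → Adj v b → Apart a b →
    InducedPath a b xs → All (λ x → x ≡ a ⊎ x ≡ b ⊎ Apart v x) xs → ⊥
  no-induced-detour chordal {v} {a} {b} {xs} va vb ab p inner = no-chord (chordal (s≤s 3≤len) cycle)
    where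
    3≤len : 3 ≤ length xs
    3≤len = induced-length p ab

    v∉xs : ∀ i → v ≢ lookup xs i
    v∉xs i v≡ with All.lookup inner (∈-lookup i)
    ... | inj₁ eq                = adj⇒≢ va (trans v≡ eq)
    ... | inj₂ (inj₁ eq)         = adj⇒≢ vb (trans v≡ eq)
    ... | inj₂ (inj₂ (v≢ , _))   = v≢ v≡

    around-injective : Injective _≡_ _≡_ (lookup (v ∷ xs))
    around-injective {zero}  {zero}  _  = refl
    around-injective {zero}  {suc j} eq = contradiction eq (v∉xs j)
    around-injective {suc i} {zero}  eq = contradiction (sym eq) (v∉xs i)
    around-injective {suc i} {suc j} eq = cong suc (induced-injective p eq)

    around-adjacent : ∀ {i j : Fin (suc (length xs))} → CyclicSuc i j →
      Adj (lookup (v ∷ xs) i) (lookup (v ∷ xs) j)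
    around-adjacent {zero}  {zero}  (inj₁ ())
    -- Index 0 succeeds itself only in a cyclic order of one element.
    around-adjacent {zero}  {zero}  (inj₂ (eq , _)) with subst (3 ≤_) (sym (suc-injective eq)) 3≤len
    ... | ()
    around-adjacent {zero}  {suc j} (inj₁ eq) =
      subst (Adj v) (sym (induced-first p j (sym (suc-injective eq)))) va
    around-adjacent {zero}  {suc j} (inj₂ (_ , ()))
    around-adjacent {suc i} {zero}  (inj₂ (eq , _)) =
      subst (λ x → Adj x v) (sym (induced-last p i (suc-injective eq))) (Adj-sym vb)
    around-adjacent {suc i} {suc j} (inj₁ eq) = induced-adjacent p i j (suc-injective eq)
    around-adjacent {suc i} {suc j} (inj₂ (_ , ()))

    cycle : Cycle G (suc (length xs))
    cycle = record
      { 3≤k       = m≤n⇒m≤1+n 3≤len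
      ; vertex    = lookup (v ∷ xs)
      ; injective = around-injective
      ; adjacent  = around-adjacent
      }

    -- By `inner` the only neighbours of `v` on the path are its ends, and these sit next to `v` in
    -- the cyclic order.
    spoke : ∀ j → Adj v (lookup xs j) →
      CyclicSuc {suc (length xs)} zero (suc j) ⊎ CyclicSuc {suc (length xs)} (suc j) zero
    spoke j e with All.lookup inner (∈-lookup j)
    ... | inj₁ eq with first-index p
    ...   | i , i≡0 , at with induced-injective p (trans at (sym eq))
    ...     | refl = inj₁ (inj₁ (cong suc (sym i≡0)))
    spoke j e | inj₂ (inj₁ eq) with last-index p
    ...   | i , i≡l , at with induced-injective p (trans at (sym eq))
    ...     | refl = inj₂ (inj₂ (cong suc i≡l , refl))
    spoke j e | inj₂ (inj₂ (_ , ¬e)) = contradiction e ¬e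

    no-chord : ¬ HasChord G cycle
    no-chord (zero  , zero  , _   , _   , e) = irrefl refl e
    no-chord (zero  , suc j , ¬ij , ¬ji , e) = [ ¬ij , ¬ji ]′ (spoke j e)
    no-chord (suc i , zero  , ¬ij , ¬ji , e) = [ ¬ji , ¬ij ]′ (spoke i (Adj-sym e))
    no-chord (suc i , suc j , ¬ij , ¬ji , e) with induced-chordless p i j (inj₂ e)
    ... | inj₁ refl       = irrefl refl e
    ... | inj₂ (inj₁ eq)  = ¬ij (inj₁ (cong suc eq))
    ... | inj₂ (inj₂ eq)  = ¬ji (inj₁ (cong suc eq))

-- Neighbours in the cyclic order

cyclic-next : ∀ {k} (i : Fin k) → ∃ λ j → CyclicSuc i j
cyclic-next {suc k} i with suc (toℕ i) <? suc k
... | yes lt = fromℕ< lt , inj₁ (sym (toℕ-fromℕ< lt))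
... | no ≮   = zero , inj₂ (≤-antisym (toℕ<n i) (≮⇒≥ ≮) , refl)

cyclic-prev : ∀ {k} (i : Fin k) → ∃ λ h → CyclicSuc h i
cyclic-prev {suc k} zero    = fromℕ k , inj₂ (cong suc (toℕ-fromℕ k) , refl)
cyclic-prev {suc k} (suc i) = inject₁ i , inj₁ (cong suc (toℕ-inject₁ i))

-- Otherwise `h` and `i` would succeed each other, which forces `k` to be at most 2.
cyclic-next≢prev : ∀ {k} {h i j : Fin k} → 3 ≤ k → CyclicSuc h i → CyclicSuc i j → h ≢ j
cyclic-next≢prev {h = h} 3≤k h→i i→j refl = go 3≤k h→i i→j
  where
  go : ∀ {h i k} → 3 ≤ k → suc h ≡ i ⊎ (suc h ≡ k × i ≡ 0) → suc i ≡ h ⊎ (suc i ≡ k × h ≡ 0) → ⊥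
  go _ (inj₁ refl) (inj₁ ())
  go (s≤s (s≤s ())) (inj₁ refl) (inj₂ (refl , refl))
  go (s≤s (s≤s ())) (inj₂ (refl , refl)) (inj₁ refl)

-- Orders with the running intersection property

module _ {n : ℕ} where

  Separates : Subset n → Subset n → List (Subset n) → Set
  Separates P S Ls = ∀ {Q x} → Q List.∈ Ls → x ∈ S → x ∈ Q → x ∈ P

  -- The newest set stands in front. Each `attach` stores a parent `P`, and these parents are the
  -- edges of the later tree.
  data RunningIntersection : List (Subset n) → Set where
    root   : ∀ S → RunningIntersection (S ∷ [])
    attach : ∀ {Ls S P} → RunningIntersection Ls → P List.∈ Ls → S List.∉ Ls →
      Separates P S Ls → RunningIntersection (S ∷ Ls)

  -- Serves to enlarge one set of an order in place. Separation need only be preserved for distinct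
  -- sets, since a fresh set differs from all older ones.
  map-runningIntersection : (f : Subset n → Subset n) → ∀ {Ls} →
    (∀ {S Q} → S List.∈ Ls → Q List.∈ Ls → f S ≡ f Q → S ≡ Q) →
    (∀ {S Q P} → S List.∈ Ls → Q List.∈ Ls → S ≢ Q → (∀ {x} → x ∈ S → x ∈ Q → x ∈ P) →
      ∀ {x} → x ∈ f S → x ∈ f Q → x ∈ f P) →
    RunningIntersection Ls → RunningIntersection (map f Ls)
  map-runningIntersection f inj pres (root S) = root (f S)
  map-runningIntersection f {S ∷ Ls} inj pres (attach {P = P} r P∈ S∉ sep) =
    attach
      (map-runningIntersection f (λ S∈ Q∈ → inj (there S∈) (there Q∈))
                                 (λ S∈ Q∈ → pres (there S∈) (there Q∈)) r)
      (∈-map⁺ f P∈) fS∉ sep′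
    where
    fS∉ : f S List.∉ map f Ls
    fS∉ fS∈ with ∈-map⁻ f fS∈
    ... | Q , Q∈ , eq = S∉ (subst (List._∈ Ls) (sym (inj (here refl) (there Q∈) eq)) Q∈)
    sep′ : ∀ {Q x} → Q List.∈ map f Ls → x ∈ f S → x ∈ Q → x ∈ f P
    sep′ Q∈ x∈S x∈Q with ∈-map⁻ f Q∈
    ... | Q₀ , Q₀∈ , refl = pres (here refl) (there Q₀∈) (λ { refl → S∉ Q₀∈ }) (sep Q₀∈) x∈S x∈Q

  -- The tree of an order

  TreeAdj : ∀ {Ls} → RunningIntersection Ls → Rel (Subset n) 0ℓ
  TreeAdj (root _) _ _ = ⊥
  TreeAdj (attach {S = S} {P} r _ _ _) X Y = TreeAdj r X Y ⊎ (X ≡ S × Y ≡ P) ⊎ (X ≡ P × Y ≡ S)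

  treeAdj? : ∀ {Ls} (r : RunningIntersection Ls) X Y → Dec (TreeAdj r X Y)
  treeAdj? (root _) _ _ = no λ ()
  treeAdj? (attach {S = S} {P} r _ _ _) X Y =
    treeAdj? r X Y ⊎-dec (X ≟ₛ S ×-dec Y ≟ₛ P) ⊎-dec (X ≟ₛ P ×-dec Y ≟ₛ S)

  treeAdj-sym : ∀ {Ls} (r : RunningIntersection Ls) {X Y} → TreeAdj r X Y → TreeAdj r Y X
  treeAdj-sym (attach r _ _ _) (inj₁ e)              = inj₁ (treeAdj-sym r e)
  treeAdj-sym (attach r _ _ _) (inj₂ (inj₁ (p , q))) = inj₂ (inj₂ (q , p))
  treeAdj-sym (attach r _ _ _) (inj₂ (inj₂ (p , q))) = inj₂ (inj₁ (q , p))

  treeAdj-∈ : ∀ {Ls} (r : RunningIntersection Ls) {X Y} → TreeAdj r X Y → Y List.∈ Ls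
  treeAdj-∈ (attach r _ _ _)  (inj₁ e)                 = there (treeAdj-∈ r e)
  treeAdj-∈ (attach r P∈ _ _) (inj₂ (inj₁ (_ , refl))) = there P∈
  treeAdj-∈ (attach r _ _ _)  (inj₂ (inj₂ (_ , refl))) = here refl

  treeAdj-irrefl : ∀ {Ls} (r : RunningIntersection Ls) {X Y} → X ≡ Y → ¬ TreeAdj r X Y
  treeAdj-irrefl (attach r _ _ _)   eq   (inj₁ e)                    = treeAdj-irrefl r eq e
  treeAdj-irrefl (attach r P∈ S∉ _) refl (inj₂ (inj₁ (refl , refl))) = S∉ P∈
  treeAdj-irrefl (attach r P∈ S∉ _) refl (inj₂ (inj₂ (refl , refl))) = S∉ P∈

  -- The vertex type is that of all subsets, so sets outside `Ls` are isolated vertices; only the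
  -- part on `Ls` is a tree.
  tree : ∀ {Ls} → RunningIntersection Ls → SimpleGraph (Subset n)
  tree r = record
    { Adj = TreeAdj r ; adj? = treeAdj? r ; sym = treeAdj-sym r ; irrefl = treeAdj-irrefl r }

  -- An older edge at `S` would put `S` into `Ls`, so the edge to the parent is the only one.
  attach-leaf : ∀ {Ls S P} (r : RunningIntersection Ls) (P∈ : P List.∈ Ls) (S∉ : S List.∉ Ls)
    (sep : Separates P S Ls) {X Y} → X ≡ S → TreeAdj (attach r P∈ S∉ sep) X Y → Y ≡ P
  attach-leaf r P∈ S∉ sep refl (inj₁ e)                 = contradiction (treeAdj-∈ r (treeAdj-sym r e)) S∉
  attach-leaf r P∈ S∉ sep refl (inj₂ (inj₁ (_ , Y≡P)))  = Y≡P
  attach-leaf r P∈ S∉ sep refl (inj₂ (inj₂ (refl , _))) = contradiction P∈ S∉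

  attach-old : ∀ {Ls S P} (r : RunningIntersection Ls) (P∈ : P List.∈ Ls) (S∉ : S List.∉ Ls)
    (sep : Separates P S Ls) {X Y} →
    X ≢ S → Y ≢ S → TreeAdj (attach {S = S} r P∈ S∉ sep) X Y → TreeAdj r X Y
  attach-old _ _ _ _ _   _   (inj₁ e)              = e
  attach-old _ _ _ _ X≢S _   (inj₂ (inj₁ (X≡S , _))) = contradiction X≡S X≢S
  attach-old _ _ _ _ _   Y≢S (inj₂ (inj₂ (_ , Y≡S))) = contradiction Y≡S Y≢S

  tree-walk : ∀ {Ls} (r : RunningIntersection Ls) {X Y} → X List.∈ Ls → Y List.∈ Ls → Walk (tree r) X Y
  tree-walk (root _) (here refl) (here refl) = ε
  tree-walk (attach r _ _ _)  (here refl) (here refl) = ε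
  tree-walk (attach r P∈ _ _) (here refl) (there Y∈)  =
    inj₂ (inj₁ (refl , refl)) ◅ Star.map inj₁ (tree-walk r P∈ Y∈)
  tree-walk (attach r P∈ _ _) (there X∈)  (here refl) =
    Star.map inj₁ (tree-walk r X∈ P∈) ◅◅ inj₂ (inj₂ (refl , refl)) ◅ ε
  tree-walk (attach r _ _ _)  (there X∈)  (there Y∈)  = Star.map inj₁ (tree-walk r X∈ Y∈)

  tree-walk-∈ : ∀ {Ls} (r : RunningIntersection Ls) {X Y} → X List.∈ Ls → Walk (tree r) X Y → Y List.∈ Ls
  tree-walk-∈ r X∈ ε       = X∈
  tree-walk-∈ r X∈ (e ◅ w) = tree-walk-∈ r (treeAdj-∈ r e) w

  -- On a cycle through the last clique both neighbours would be its parent.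
  tree-acyclic : ∀ {Ls} (r : RunningIntersection Ls) → Acyclic (tree r)
  tree-acyclic (root _) {suc k} c = Cycle.adjacent c (proj₂ (cyclic-next zero))
  tree-acyclic (root _) {ℕ.zero} c with Cycle.3≤k c
  ... | ()
  tree-acyclic (attach {S = S} r P∈ S∉ sep) {k} c with any? (λ i → Cycle.vertex c i ≟ₛ S)
  ... | yes (i , i≡S) =
    let j , i→j = cyclic-next i
        h , h→i = cyclic-prev i
        t = attach r P∈ S∉ sep
    in cyclic-next≢prev (Cycle.3≤k c) h→i i→j (Cycle.injective c (trans
         (attach-leaf r P∈ S∉ sep i≡S (treeAdj-sym t (Cycle.adjacent c h→i)))
         (sym (attach-leaf r P∈ S∉ sep i≡S (Cycle.adjacent c i→j)))))
  ... | no none = tree-acyclic r record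
    { 3≤k       = Cycle.3≤k c
    ; vertex    = Cycle.vertex c
    ; injective = Cycle.injective c
    ; adjacent  = λ {i} {j} i→j →
        attach-old r P∈ S∉ sep (λ eq → none (i , eq)) (λ eq → none (j , eq)) (Cycle.adjacent c i→j)
    }

  module _ {Ls : List (Subset n)} {S P : Subset n}
    (r : RunningIntersection Ls) (P∈ : P List.∈ Ls) (S∉ : S List.∉ Ls) (sep : Separates P S Ls) where

    private
      t : RunningIntersection (S ∷ Ls)
      t = attach r P∈ S∉ sep

    -- A path from an old clique can meet the new leaf S only at its very end.
    retract : ∀ {X Y} (w : Walk (tree t) X Y) → IsPath (tree t) w → X ≢ S →
      (∃ λ (w′ : Walk (tree r) X Y) → IsPath (tree r) w′ × vertices (tree t) w ≡ vertices (tree r) w′) ⊎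
      (Y ≡ S × ∃ λ (w′ : Walk (tree r) X P) →
        IsPath (tree r) w′ × vertices (tree t) w ≡ vertices (tree r) w′ ∷ʳ S)
    retract ε u X≢S = inj₁ (ε , [] ∷ [] , refl)
    retract (_◅_ {j = Z} e w) (x∉ ∷ u) X≢S with Z ≟ₛ S
    ... | no Z≢S with retract w u Z≢S
    ...   | inj₁ (w′ , u′ , eq) =
      inj₁ (attach-old r P∈ S∉ sep X≢S Z≢S e ◅ w′ , subst (All _) eq x∉ ∷ u′ , cong (_ ∷_) eq)
    ...   | inj₂ (Y≡S , w′ , u′ , eq) =
      inj₂ (Y≡S , attach-old r P∈ S∉ sep X≢S Z≢S e ◅ w′ ,
            ++⁻ˡ _ (subst (All _) eq x∉) ∷ u′ , cong (_ ∷_) eq)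
    retract (e ◅ w) (x∉ ∷ u) X≢S | yes refl with attach-leaf r P∈ S∉ sep refl (treeAdj-sym t e)
    retract (e ◅ ε) _ _ | yes refl | refl = inj₂ (refl , ε , [] ∷ [] , refl)
    -- A step on from `S` would lead back to `P`, which the path has already visited.
    retract (e ◅ e′ ◅ w) ((_ ∷ x∉) ∷ _) _ | yes refl | refl =
      contradiction (sym (attach-leaf r P∈ S∉ sep refl e′)) (All.lookup x∉ (start∈vertices (tree t) w))

  -- Induction on the order. If one end of the path is the newest set and the other is older,
  -- separation puts `v` into the parent, and the rest of the path lies in the older tree.
  tree-path-∋ : ∀ {Ls} (r : RunningIntersection Ls) {X Y v} (w : Walk (tree r) X Y) →
    IsPath (tree r) w → X List.∈ Ls → Y List.∈ Ls → v ∈ X → v ∈ Y → All (v ∈_) (vertices (tree r) w)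
  tree-path-∋ r ε u X∈ Y∈ v∈X v∈Y = v∈X ∷ []
  tree-path-∋ (attach {Ls} {S} {P} r P∈ S∉ sep) {v = v} (e ◅ w) (x∉ ∷ u) (here refl) Y∈ v∈X v∈Y
    with attach-leaf r P∈ S∉ sep refl e
  ... | refl = v∈X ∷ after Y∈ (retract r P∈ S∉ sep w u λ { refl → S∉ P∈ })
    where
    t : RunningIntersection (S ∷ Ls)
    t = attach r P∈ S∉ sep
    after : _ List.∈ S ∷ Ls → _ → All (v ∈_) (vertices (tree t) w)
    after _           (inj₂ (refl , _))    = contradiction refl (All.lookup x∉ (end∈vertices (tree t) w))
    after (here refl) (inj₁ _)             = contradiction refl (All.lookup x∉ (end∈vertices (tree t) w))
    after (there Y∈)  (inj₁ (w′ , u′ , eq)) =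
      subst (All _) (sym eq) (tree-path-∋ r w′ u′ P∈ Y∈ (sep Y∈ v∈X v∈Y) v∈Y)
  tree-path-∋ (attach r P∈ S∉ sep) (e ◅ w) u (there X∈) Y∈ v∈X v∈Y
    with retract r P∈ S∉ sep (e ◅ w) u (λ { refl → S∉ X∈ })
  ... | inj₁ (w′ , u′ , eq) =
    subst (All _) (sym eq) (tree-path-∋ r w′ u′ X∈ (tree-walk-∈ r X∈ w′) v∈X v∈Y)
  ... | inj₂ (refl , w′ , u′ , eq) =
    subst (All _) (sym eq) (++⁺ (tree-path-∋ r w′ u′ X∈ P∈ v∈X (sep X∈ v∈Y v∈X)) (v∈Y ∷ []))

-- Simplicial vertices of induced subgraphs

module _ {n : ℕ} (G : SimpleGraph (Fin n)) where
  open SimpleGraph G renaming (sym to Adj-sym)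

  apart? : ∀ u v → Dec (Apart G u v)
  apart? u v = ¬? (u ≟ v) ×-dec ¬? (adj? u v)

  apart-sym : ∀ {u v} → Apart G u v → Apart G v u
  apart-sym (u≢v , ¬e) = ≢-sym u≢v , ¬e ∘ Adj-sym

  ¬apart⇒adj : ∀ {u v} → u ≢ v → ¬ Apart G u v → Adj u v
  ¬apart⇒adj {u} {v} u≢v ¬ap = decidable-stable (adj? u v) λ ¬e → ¬ap (u≢v , ¬e)

  SimplicialIn : Subset n → Pred (Fin n) 0ℓ
  SimplicialIn U s = ∀ {a b} → a ∈ U → b ∈ U → Adj s a → Adj s b → a ≢ b → Adj a b

  AdjIn : Subset n → Rel (Fin n) 0ℓ
  AdjIn W u v = Adj u v × u ∈ W × v ∈ W

  -- Grown from `x` alone; each added vertex prolongs a walk that reaches one of its neighbours.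
  component : ∀ W {x} → x ∈ W → ∃ λ K →
    (K ⊆ W × x ∈ K × (∀ {k} → k ∈ K → Star (AdjIn W) x k)) ×
    (∀ {k w} → k ∈ K → w ∈ W → Adj k w → w ∈ K)
  component W {x} x∈W = saturate _ _ step
    {K = ⁅ x ⁆} ( (λ k∈ → subst (_∈ W) (sym (x∈⁅y⁆⇒x≡y x k∈)) x∈W)
                , x∈⁅x⁆ x
                , λ k∈ → subst (Star (AdjIn W) x) (sym (x∈⁅y⁆⇒x≡y x k∈)) ε )
    where
    step : ∀ {K} → (K ⊆ W × x ∈ K × (∀ {k} → k ∈ K → Star (AdjIn W) x k)) →
      (∀ {k w} → k ∈ K → w ∈ W → Adj k w → w ∈ K) ⊎
      ∃ λ w → w ∉ K × (K ∪ ⁅ w ⁆ ⊆ W × x ∈ K ∪ ⁅ w ⁆ × (∀ {k} → k ∈ K ∪ ⁅ w ⁆ → Star (AdjIn W) x k))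
    step {K} (K⊆W , x∈K , reach)
      with any? (λ k → any? (λ w → k ∈? K ×-dec w ∈? W ×-dec adj? k w ×-dec ¬? (w ∈? K)))
    ... | no none = inj₁ λ {k} {w} k∈ w∈ e →
      decidable-stable (w ∈? K) λ w∉ → none (k , w , k∈ , w∈ , e , w∉)
    ... | yes (k , w , k∈ , w∈ , e , w∉) = inj₂ (w , w∉ , ⊆W , p⊆p∪q ⁅ w ⁆ x∈K , reach′)
      where
      ⊆W : K ∪ ⁅ w ⁆ ⊆ W
      ⊆W y∈ with ∈-∪⁅⁆⁻ y∈
      ... | inj₁ y∈K  = K⊆W y∈K
      ... | inj₂ refl = w∈
      reach′ : ∀ {y} → y ∈ K ∪ ⁅ w ⁆ → Star (AdjIn W) x y
      reach′ y∈ with ∈-∪⁅⁆⁻ y∈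
      ... | inj₁ y∈K  = reach y∈K
      ... | inj₂ refl = reach k∈ ◅◅ (e , K⊆W k∈ , w∈) ◅ ε

  -- K is a component of the non-neighbours of v in U and N is K with its
  -- neighbours; chordality makes N ∖ K a clique, and v is not in N.
  module Detour (chordal : Chordal G) {U : Subset n} {v : Fin n} where
    nonNbr? : Decidable (λ u → u ∈ U × Apart G v u)
    nonNbr? u = u ∈? U ×-dec apart? v u

    W : Subset n
    W = ⟦ nonNbr? ⟧

    W⇒apart : ∀ {u} → u ∈ W → Apart G v u
    W⇒apart = proj₂ ∘ ∈-⟦⟧⁻ nonNbr?

    module _ {x : Fin n} {K : Subset n} (K⊆W : K ⊆ W)
      (reach : ∀ {k} → k ∈ K → Star (AdjIn W) x k)
      (closed : ∀ {k w} → k ∈ K → w ∈ W → Adj k w → w ∈ K) where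

      near? : Decidable (λ u → u ∈ U × (u ∈ K ⊎ ∃ λ k → k ∈ K × Adj u k))
      near? u = u ∈? U ×-dec (u ∈? K ⊎-dec any? λ k → k ∈? K ×-dec adj? u k)

      N : Subset n
      N = ⟦ near? ⟧

      v∉N : v ∉ N
      v∉N v∈ with proj₂ (∈-⟦⟧⁻ near? v∈)
      ... | inj₁ v∈K           = proj₁ (W⇒apart (K⊆W v∈K)) refl
      ... | inj₂ (k , k∈ , e) = proj₂ (W⇒apart (K⊆W k∈)) e

      K⊆N : K ⊆ N
      K⊆N k∈ = ∈-⟦⟧⁺ near? (proj₁ (∈-⟦⟧⁻ nonNbr? (K⊆W k∈)) , inj₁ k∈)

      N⊆U : N ⊆ U
      N⊆U = proj₁ ∘ ∈-⟦⟧⁻ near?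

      -- A non-neighbour of `v` in `U` that is adjacent to `K` would already belong to the
      -- component.
      boundary : ∀ {s} → s ∈ N → s ∉ K → Adj v s × ∃ λ k → k ∈ K × Adj s k
      boundary {s} s∈ s∉K with ∈-⟦⟧⁻ near? s∈
      ... | _   , inj₁ s∈K          = contradiction s∈K s∉K
      ... | s∈U , inj₂ (k , k∈ , e) = ¬apart⇒adj (λ { refl → v∉N s∈ }) not-apart , k , k∈ , e
        where
        not-apart : ¬ Apart G v s
        not-apart ap = s∉K (closed k∈ (∈-⟦⟧⁺ nonNbr? (s∈U , ap)) (Adj-sym e))

      -- Two apart vertices `s` and `t` would be neighbours of `v` joined by an induced path through
      -- non-neighbours of `v`, against chordality.
      boundary-clique : ∀ {s t} → s ∈ N → s ∉ K → t ∈ N → t ∉ K → ¬ Apart G s t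
      boundary-clique {s} {t} s∈ s∉ t∈ t∉ ap
        with boundary s∈ s∉ | boundary t∈ t∉
      ... | vs , k , k∈ , sk | vt , l , l∈ , tl
        with inducedPath G _≟_ {Q = λ y → y ≡ s ⊎ y ≡ t ⊎ Apart G v y}
               -- The walk goes from `s` to `k`, back to the base point `x` of the component, out to
               -- `l` and on to `t`.
               ((sk , inj₁ refl) ◅ Star.map (λ (e , u∈ , _) → e , inj₂ (inj₂ (W⇒apart u∈)))
                 (Star.reverse (λ (e , u∈ , w∈) → Adj-sym e , w∈ , u∈) (reach k∈) ◅◅ reach l∈))
               (Adj-sym tl) (inj₂ (inj₂ (W⇒apart (K⊆W l∈)))) (inj₂ (inj₁ refl))
      ... | _ , p , inner = no-induced-detour G chordal vs vt ap p inner

      -- All neighbours in `U` of a vertex of `K` belong to `N`.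
      simplicial-lift : ∀ {k} → k ∈ K → SimplicialIn N k → SimplicialIn U k
      simplicial-lift {k} k∈ simp a∈ b∈ ka kb =
        simp (∈-⟦⟧⁺ near? (a∈ , inj₂ (k , k∈ , Adj-sym ka)))
             (∈-⟦⟧⁺ near? (b∈ , inj₂ (k , k∈ , Adj-sym kb))) ka kb

  ApartPair : Subset n → Set
  ApartPair U = ∃₂ λ s t → s ∈ U × t ∈ U × Apart G s t

  apartPair? : ∀ U → Dec (ApartPair U)
  apartPair? U = any? λ s → any? λ t → s ∈? U ×-dec t ∈? U ×-dec apart? s t

  ¬apartPair⇒simplicialIn : ∀ {U} → ¬ ApartPair U → ∀ {s} → SimplicialIn U s
  ¬apartPair⇒simplicialIn none a∈ b∈ _ _ a≢b =
    ¬apart⇒adj a≢b λ ap → none (_ , _ , a∈ , b∈ , ap)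

  -- Dirac's lemma, with v added for the sake of the induction: applied to N at a
  -- vertex of the clique N ∖ K, the hypothesis yields a vertex of K.
  dirac : Chordal G → ∀ {U} → Acc _⊂_ U → ∀ {v x} → v ∈ U → x ∈ U → Apart G v x →
    ∃ λ s → s ∈ U × Apart G v s × SimplicialIn U s
  dirac chordal {U} (acc rec) {v} {x} v∈ x∈ vx
    with component (Detour.W chordal {U} {v}) (∈-⟦⟧⁺ (Detour.nonNbr? chordal) (x∈ , vx))
  ... | K , (K⊆W , x∈K , reach) , closed = conclude interior
    where
    open Detour chordal {U} {v}
    N′ : Subset n
    N′ = N K⊆W reach closed

    ih : ∀ {s t} → s ∈ N′ → t ∈ N′ → Apart G s t → ∃ λ r → r ∈ N′ × Apart G s r × SimplicialIn N′ r
    ih = dirac chordal (rec (N⊆U K⊆W reach closed , v , v∈ , v∉N K⊆W reach closed))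

    interior : ∃ λ k → k ∈ K × SimplicialIn N′ k
    interior with apartPair? N′
    ... | no none = x , x∈K , ¬apartPair⇒simplicialIn none
    ... | yes (s , y , s∈ , y∈ , sy) with ih s∈ y∈ sy
    ...   | t , t∈ , st , t-simp with t ∈? K
    ...     | yes t∈K = t , t∈K , t-simp
    -- Now `t` is in the clique `N ∖ K`, so a vertex apart from `t` must fall into `K`.
    ...     | no t∉K with ih t∈ s∈ (apart-sym st)
    ...       | r , r∈ , tr , r-simp with r ∈? K
    ...         | yes r∈K = r , r∈K , r-simp
    ...         | no r∉K  = contradiction tr (boundary-clique K⊆W reach closed t∈ t∉K r∈ r∉K)

    conclude : (∃ λ k → k ∈ K × SimplicialIn N′ k) → ∃ λ s → s ∈ U × Apart G v s × SimplicialIn U s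
    conclude (k , k∈ , simp) =
      k , N⊆U K⊆W reach closed (K⊆N K⊆W reach closed k∈) , W⇒apart (K⊆W k∈) ,
      simplicial-lift K⊆W reach closed k∈ simp

  simplicial-exists : Chordal G → ∀ {U} → Nonempty U → ∃ λ s → s ∈ U × SimplicialIn U s
  simplicial-exists chordal {U} (x , x∈) with apartPair? U
  ... | no none = x , x∈ , ¬apartPair⇒simplicialIn none
  ... | yes (_ , _ , s∈ , t∈ , ap) =
    let s , s∈U , _ , simp = dirac chordal (⊂-wellFounded U) s∈ t∈ ap in s , s∈U , simp

  -- Maximal cliques of induced subgraphs

  AdjAll : Fin n → Subset n → Set
  AdjAll w S = ∀ u → u ∈ S → u ≢ w → Adj w u

  adjAll? : ∀ w S → Dec (AdjAll w S)
  adjAll? w S = all? λ u → u ∈? S →-dec ¬? (u ≟ w) →-dec adj? w u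

  -- Maximality is tested on single vertices instead of larger cliques, which makes it decidable by
  -- a search over vertices.
  record MaximalIn (U S : Subset n) : Set where
    field
      inside  : S ⊆ U
      clique  : IsClique G (_∈ S)
      maximal : ∀ {w} → w ∈ U → AdjAll w S → w ∈ S
  open MaximalIn

  maximalIn? : ∀ U S → Dec (MaximalIn U S)
  maximalIn? U S = map′
    (λ (i , c , m) → record
      { inside = i _ ; clique = λ u∈ v∈ u≢v → c _ _ u∈ v∈ u≢v ; maximal = λ w∈ a → m _ w∈ a })
    (λ M → (λ _ → inside M) , (λ _ _ u∈ v∈ u≢v → clique M u∈ v∈ u≢v) , λ _ → maximal M)
    ((all? λ x → x ∈? S →-dec x ∈? U) ×-dec
     (all? λ u → all? λ v → u ∈? S →-dec v ∈? S →-dec ¬? (u ≟ v) →-dec adj? u v) ×-dec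
     (all? λ w → w ∈? U →-dec adjAll? w S →-dec w ∈? S))

  insert-clique : ∀ {S w} → IsClique G (_∈ S) → AdjAll w S → IsClique G (_∈ S ∪ ⁅ w ⁆)
  insert-clique c a u∈ v∈ u≢v with ∈-∪⁅⁆⁻ u∈ | ∈-∪⁅⁆⁻ v∈
  ... | inj₁ u∈S  | inj₁ v∈S  = c u∈S v∈S u≢v
  ... | inj₁ u∈S  | inj₂ refl = Adj-sym (a _ u∈S u≢v)
  ... | inj₂ refl | inj₁ v∈S  = a _ v∈S (≢-sym u≢v)
  ... | inj₂ refl | inj₂ refl = contradiction refl u≢v

  record CliqueAbove (U S M : Subset n) : Set where
    field
      above   : S ⊆ M
      inside′ : M ⊆ U
      clique′ : IsClique G (_∈ M)
  open CliqueAbove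

  extendClique : ∀ {U S} → S ⊆ U → IsClique G (_∈ S) → ∃ λ M → MaximalIn U M × S ⊆ M
  extendClique {U} {S} S⊆U c =
    let M , i , m = saturate (CliqueAbove U S) (λ M → ∀ {w} → w ∈ U → AdjAll w M → w ∈ M) step
                      record { above = id ; inside′ = S⊆U ; clique′ = c }
    in M , record { inside = inside′ i ; clique = clique′ i ; maximal = m } , above i
    where
    step : ∀ {M} → CliqueAbove U S M →
      (∀ {w} → w ∈ U → AdjAll w M → w ∈ M) ⊎ ∃ λ w → w ∉ M × CliqueAbove U S (M ∪ ⁅ w ⁆)
    step {M} i with any? (λ w → w ∈? U ×-dec adjAll? w M ×-dec ¬? (w ∈? M))
    ... | no none = inj₁ λ {w} w∈ a → decidable-stable (w ∈? M) λ w∉ → none (w , w∈ , a , w∉)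
    ... | yes (w , w∈ , a , w∉) = inj₂ (w , w∉ , record
      { above   = p⊆p∪q ⁅ w ⁆ ∘ above i
      ; inside′ = λ x∈ → [ inside′ i , (λ { refl → w∈ }) ]′ (∈-∪⁅⁆⁻ x∈)
      ; clique′ = insert-clique (clique′ i) a
      })

  maximal-≡ : ∀ {U S T} → MaximalIn U S → T ⊆ U → IsClique G (_∈ T) → S ⊆ T → S ≡ T
  maximal-≡ M T⊆U c S⊆T =
    ⊆-antisym S⊆T λ t∈ → maximal M (T⊆U t∈) λ u u∈ u≢t → c t∈ (S⊆T u∈) (≢-sym u≢t)

  maximalIn-full⁻ : ∀ {S} → MaximalIn full S → IsMaximalClique G S
  maximalIn-full⁻ M = clique M , λ c → maximal-≡ M ⊆⊤ c

  maximalIn-full⁺ : ∀ {S} → IsMaximalClique G S → MaximalIn full S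
  maximalIn-full⁺ {S} (c , m) = record
    { inside  = ⊆⊤
    ; clique  = c
    ; maximal = λ {w} _ a → subst (w ∈_) (sym (m (insert-clique c a) (p⊆p∪q ⁅ w ⁆))) (y∈p∪⁅y⁆ {p = S})
    }

  -- Clique orders by removal of simplicial vertices

  CliqueOrder : Subset n → Set
  CliqueOrder U = ∃ λ Ls → RunningIntersection Ls ×
    (∀ {S} → S List.∈ Ls → MaximalIn U S) × (∀ {S} → MaximalIn U S → S List.∈ Ls)

  module AddSimplicial {U : Subset n} {v : Fin n} (v∈U : v ∈ U) (simp : SimplicialIn U v) where

    nbr? : Decidable (λ u → u ∈ U - v × Adj v u)
    nbr? u = u ∈? U - v ×-dec adj? v u

    K K⁺ : Subset n
    K  = ⟦ nbr? ⟧
    K⁺ = K ∪ ⁅ v ⁆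

    U-v⊆U : U - v ⊆ U
    U-v⊆U = p─q⊆p U ⁅ v ⁆

    K⊆U-v : K ⊆ U - v
    K⊆U-v = proj₁ ∘ ∈-⟦⟧⁻ nbr?

    adj-K : ∀ {u} → u ∈ K → Adj v u
    adj-K = proj₂ ∘ ∈-⟦⟧⁻ nbr?

    v∉U-v : v ∉ U - v
    v∉U-v = x∉p-x

    ∈U-v : ∀ {u} → u ∈ U → u ≢ v → u ∈ U - v
    ∈U-v = x∈p∧x≢y⇒x∈p-y

    K-clique : IsClique G (_∈ K)
    K-clique a∈ b∈ = simp (U-v⊆U (K⊆U-v a∈)) (U-v⊆U (K⊆U-v b∈)) (adj-K a∈) (adj-K b∈)

    K⁺-clique : IsClique G (_∈ K⁺)
    K⁺-clique = insert-clique K-clique λ u u∈ _ → adj-K u∈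

    K⁺⊆U : K⁺ ⊆ U
    K⁺⊆U x∈ with ∈-∪⁅⁆⁻ {p = K} x∈
    ... | inj₁ x∈K  = U-v⊆U (K⊆U-v x∈K)
    ... | inj₂ refl = v∈U

    v∈K⁺ : v ∈ K⁺
    v∈K⁺ = y∈p∪⁅y⁆ {p = K}

    ⊆K : ∀ {S} → S ⊆ U → v ∉ S → AdjAll v S → S ⊆ K
    ⊆K S⊆U v∉S a {u} u∈ = ∈-⟦⟧⁺ nbr? (∈U-v (S⊆U u∈) u≢v , a u u∈ u≢v)
      where
      u≢v : u ≢ v
      u≢v refl = v∉S u∈

    K⁺-maximal : MaximalIn U K⁺
    K⁺-maximal = record { inside = K⁺⊆U ; clique = K⁺-clique ; maximal = max }
      where
      max : ∀ {w} → w ∈ U → AdjAll w K⁺ → w ∈ K⁺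
      max {w} w∈ a with w ≟ v
      ... | yes refl = v∈K⁺
      ... | no w≢v   = p⊆p∪q ⁅ v ⁆ (∈-⟦⟧⁺ nbr? (∈U-v w∈ w≢v , Adj-sym (a v v∈K⁺ (≢-sym w≢v))))

    -- Apart from `v`, such an `S` consists of neighbours of `v`, so it lies inside the clique `K⁺`.
    maximal∋v⇒K⁺ : ∀ {S} → MaximalIn U S → v ∈ S → S ≡ K⁺
    maximal∋v⇒K⁺ {S} M v∈S = maximal-≡ M K⁺⊆U K⁺-clique S⊆K⁺
      where
      S⊆K⁺ : S ⊆ K⁺
      S⊆K⁺ {u} u∈ with u ≟ v
      ... | yes refl = v∈K⁺
      ... | no u≢v   = p⊆p∪q ⁅ v ⁆ (∈-⟦⟧⁺ nbr? (∈U-v (inside M u∈) u≢v , clique M v∈S u∈ (≢-sym u≢v)))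

    -- The set `K` is excluded because `v` can be added to it. With `maximal-extend`, deleting `v`
    -- affects the maximal cliques only at `K` and `K⁺`.
    maximal-restrict : ∀ {S} → MaximalIn U S → v ∉ S → MaximalIn (U - v) S × S ≢ K
    maximal-restrict M v∉S = record
      { inside  = λ u∈ → ∈U-v (inside M u∈) λ { refl → v∉S u∈ }
      ; clique  = clique M
      ; maximal = maximal M ∘ U-v⊆U
      } , λ { refl → v∉S (maximal M v∈U λ u u∈ _ → adj-K u∈) }

    -- Only `v` could newly enlarge `S`; then `S` would lie in `K`, and maximality in `U - v` would
    -- make them equal.
    maximal-extend : ∀ {S} → MaximalIn (U - v) S → S ≢ K → MaximalIn U S
    maximal-extend {S} M S≢K = record { inside = U-v⊆U ∘ inside M ; clique = clique M ; maximal = max }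
      where
      max : ∀ {w} → w ∈ U → AdjAll w S → w ∈ S
      max {w} w∈ a with w ≟ v
      ... | no w≢v   = maximal M (∈U-v w∈ w≢v) a
      ... | yes refl =
        contradiction (maximal-≡ M K⊆U-v K-clique (⊆K (U-v⊆U ∘ inside M) (v∉U-v ∘ inside M) a)) S≢K

    -- No clique of the old order contains `v`, so after `K` becomes `K⁺` the new point lies in one
    -- set only and in no intersection of two.
    replaceOrder : MaximalIn (U - v) K → CliqueOrder (U - v) → CliqueOrder U
    replaceOrder maxK (Ls , r , sound , complete) =
      map f Ls , map-runningIntersection f f-inj f-sep r , sound′ , complete′
      where
      f : Subset n → Subset n
      f S with S ≟ₛ K
      ... | yes _ = K⁺
      ... | no _  = S

      f-K : f K ≡ K⁺
      f-K with K ≟ₛ K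
      ... | yes _  = refl
      ... | no K≢K = contradiction refl K≢K

      f-≢ : ∀ {S} → S ≢ K → f S ≡ S
      f-≢ {S} S≢K with S ≟ₛ K
      ... | yes S≡K = contradiction S≡K S≢K
      ... | no _    = refl

      v∉ : ∀ {S} → S List.∈ Ls → v ∉ S
      v∉ S∈ = v∉U-v ∘ inside (sound S∈)

      f-inj : ∀ {S Q} → S List.∈ Ls → Q List.∈ Ls → f S ≡ f Q → S ≡ Q
      f-inj {S} {Q} S∈ Q∈ eq with S ≟ₛ K | Q ≟ₛ K
      ... | yes refl | yes refl = refl
      ... | yes refl | no _     = contradiction (subst (v ∈_) eq v∈K⁺) (v∉ Q∈)
      ... | no _     | yes refl = contradiction (subst (v ∈_) (sym eq) v∈K⁺) (v∉ S∈)
      ... | no _     | no _     = eq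

      S⊆fS : ∀ {S} → S ⊆ f S
      S⊆fS {S} with S ≟ₛ K
      ... | yes refl = p⊆p∪q ⁅ v ⁆
      ... | no _     = id

      f⁻ : ∀ {S x} → x ∈ f S → x ∈ S ⊎ (x ≡ v × S ≡ K)
      f⁻ {S} x∈ with S ≟ₛ K
      ... | no _ = inj₁ x∈
      ... | yes refl with ∈-∪⁅⁆⁻ {p = K} x∈
      ...   | inj₁ x∈K = inj₁ x∈K
      ...   | inj₂ x≡v = inj₂ (x≡v , refl)

      f-sep : ∀ {S Q P} → S List.∈ Ls → Q List.∈ Ls → S ≢ Q → (∀ {x} → x ∈ S → x ∈ Q → x ∈ P) →
        ∀ {x} → x ∈ f S → x ∈ f Q → x ∈ f P
      f-sep {P = P} S∈ Q∈ S≢Q sep x∈S x∈Q with f⁻ x∈S | f⁻ x∈Q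
      ... | inj₁ x∈S′         | inj₁ x∈Q′         = S⊆fS {P} (sep x∈S′ x∈Q′)
      ... | inj₁ x∈S′         | inj₂ (refl , _)   = contradiction x∈S′ (v∉ S∈)
      ... | inj₂ (refl , _)   | inj₁ x∈Q′         = contradiction x∈Q′ (v∉ Q∈)
      ... | inj₂ (_ , refl)   | inj₂ (_ , refl)   = contradiction refl S≢Q

      sound′ : ∀ {S} → S List.∈ map f Ls → MaximalIn U S
      sound′ S∈ with ∈-map⁻ f S∈
      ... | Q , Q∈ , refl with Q ≟ₛ K
      ...   | yes _  = K⁺-maximal
      ...   | no Q≢K = maximal-extend (sound Q∈) Q≢K

      complete′ : ∀ {S} → MaximalIn U S → S List.∈ map f Ls
      complete′ {S} M with v ∈? S
      ... | yes v∈ =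
        subst (List._∈ map f Ls) (trans f-K (sym (maximal∋v⇒K⁺ M v∈))) (∈-map⁺ f (complete maxK))
      ... | no v∉S =
        let M′ , S≢K = maximal-restrict M v∉S in
        subst (List._∈ map f Ls) (f-≢ S≢K) (∈-map⁺ f (complete M′))

    -- As no older clique contains `v`, all that `K⁺` shares with them lies in `K`; any maximal
    -- clique around `K` can be the parent.
    attachOrder : ¬ MaximalIn (U - v) K → CliqueOrder (U - v) → CliqueOrder U
    attachOrder ¬maxK (Ls , r , sound , complete) =
      let P , maxP , K⊆P = extendClique K⊆U-v K-clique in
      K⁺ ∷ Ls , attach r (complete maxP) (λ K⁺∈ → v∉U-v (inside (sound K⁺∈) v∈K⁺)) (sep K⊆P) ,
      sound′ , complete′
      where
      sep : ∀ {P} → K ⊆ P → ∀ {Q x} → Q List.∈ Ls → x ∈ K⁺ → x ∈ Q → x ∈ P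
      sep K⊆P Q∈ x∈ x∈Q with ∈-∪⁅⁆⁻ {p = K} x∈
      ... | inj₁ x∈K  = K⊆P x∈K
      ... | inj₂ refl = contradiction (inside (sound Q∈) x∈Q) v∉U-v
      sound′ : ∀ {S} → S List.∈ K⁺ ∷ Ls → MaximalIn U S
      sound′ (here refl) = K⁺-maximal
      sound′ (there S∈)  = maximal-extend (sound S∈) λ { refl → ¬maxK (sound S∈) }
      complete′ : ∀ {S} → MaximalIn U S → S List.∈ K⁺ ∷ Ls
      complete′ {S} M with v ∈? S
      ... | yes v∈ = here (maximal∋v⇒K⁺ M v∈)
      ... | no v∉  = there (complete (proj₁ (maximal-restrict M v∉)))

  -- The empty set is the one maximal clique of the empty graph and gives the root; the first vertex
  -- added turns it into a singleton through `replaceOrder`.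
  emptyOrder : ∀ {U} → ¬ Nonempty U → CliqueOrder U
  emptyOrder {U} empty = U ∷ [] , root U , (λ { (here refl) → record
      { inside = id ; clique = λ u∈ → contradiction (_ , u∈) empty ; maximal = λ w∈ _ → w∈ } })
    , λ M → here (⊆-antisym (inside M) λ x∈ → contradiction (_ , x∈) empty)

  cliqueOrder : Chordal G → ∀ U → CliqueOrder U
  cliqueOrder chordal U = go (⊂-wellFounded U)
    where
    go : ∀ {U} → Acc _⊂_ U → CliqueOrder U
    go {U} (acc rec) with nonempty? U
    ... | no empty = emptyOrder empty
    ... | yes ne = step (simplicial-exists chordal ne)
      where
      step : (∃ λ s → s ∈ U × SimplicialIn U s) → CliqueOrder U
      step (s , s∈ , simp) with maximalIn? (U - s) (AddSimplicial.K s∈ simp)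
      ... | yes maxK = AddSimplicial.replaceOrder s∈ simp maxK (go (rec (x∈p⇒p-x⊂p s∈)))
      ... | no ¬maxK = AddSimplicial.attachOrder s∈ simp ¬maxK (go (rec (x∈p⇒p-x⊂p s∈)))

  -- Maximal cliques of the whole graph and their simplicial vertices

  simplicial? : Decidable (Simplicial G)
  simplicial? v = map′ (λ h va vb a≢b → h _ _ va vb a≢b) (λ h _ _ va vb a≢b → h va vb a≢b)
    (all? λ a → all? λ b → adj? v a →-dec adj? v b →-dec ¬? (a ≟ b) →-dec adj? a b)

  simp? : ∀ C → Decidable (Simp G C)
  simp? C v = v ∈? value C ×-dec simplicial? v

  maximalClique : ∀ {S} → MaximalIn full S → MaximalClique G
  maximalClique {S} M = S , Irrelevant.[ maximalIn-full⁻ M ]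

  -- The stored maximality proof is irrelevant, so a usable one is recomputed by decision.
  maximalIn : (C : MaximalClique G) → MaximalIn full (value C)
  maximalIn (S , Irrelevant.[ m ]) = recompute (maximalIn? full S) (maximalIn-full⁺ m)

  -- The members of `S` and of `C` other than `v` are neighbours of the simplicial `v`, hence
  -- adjacent to each other when distinct. So each `u` in `S` is adjacent to the rest of `C`, and
  -- maximality applies.
  simp-absorbs : ∀ C {S v} → Simp G C v → IsClique G (_∈ S) → v ∈ S → S ⊆ value C
  simp-absorbs C {S} {v} (v∈C , simp) c v∈S {u} u∈ = maximal (maximalIn C) ∈⊤ adj
    where
    adj : AdjAll u (value C)
    adj x x∈ x≢u with x ≟ v | u ≟ v
    ... | yes refl | _        = c u∈ v∈S (≢-sym x≢u)
    ... | no _     | yes refl = clique (maximalIn C) v∈C x∈ (≢-sym x≢u)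
    ... | no x≢v   | no u≢v   =
      simp (c v∈S u∈ (≢-sym u≢v)) (clique (maximalIn C) v∈C x∈ (≢-sym x≢v)) (≢-sym x≢u)

  simp-unique : ∀ C {S v} → MaximalIn full S → Simp G C v → v ∈ S → S ≡ value C
  simp-unique C M sv v∈S =
    maximal-≡ M ⊆⊤ (clique (maximalIn C)) (simp-absorbs C sv (clique M) v∈S)

  -- If all neighbours of `v` were in `C`, they would form a clique.
  ¬simplicial⇒outer : ∀ C {v} → v ∈ value C → ¬ Simplicial G v → ∃ λ w → w ∉ value C × Adj v w
  ¬simplicial⇒outer C {v} v∈ ¬simp with any? (λ w → ¬? (w ∈? value C) ×-dec adj? v w)
  ... | yes outer = outer
  ... | no none = ⊥-elim (¬simp λ va vb → clique (maximalIn C) (within va) (within vb))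
    where
    within : ∀ {u} → Adj v u → u ∈ value C
    within {u} e = decidable-stable (u ∈? value C) λ u∉ → none (u , u∉ , e)

  edge-clique : ∀ {v w} → Adj v w → ∃ λ S → MaximalIn full S × v ∈ S × w ∈ S
  edge-clique {v} {w} e =
    let S , M , ⊆S = extendClique ⊆⊤ (insert-clique single adj)
    in S , M , ⊆S (p⊆p∪q ⁅ w ⁆ (x∈⁅x⁆ v)) , ⊆S (y∈p∪⁅y⁆ {p = ⁅ v ⁆})
    where
    single : IsClique G (_∈ ⁅ v ⁆)
    single a∈ b∈ a≢b = contradiction (trans (x∈⁅y⁆⇒x≡y v a∈) (sym (x∈⁅y⁆⇒x≡y v b∈))) a≢b
    adj : AdjAll w ⁅ v ⁆
    adj u u∈ _ with x∈⁅y⁆⇒x≡y v u∈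
    ... | refl = Adj-sym e

  -- From an endpoint to a separator

  endpoint-neighbour∈ : ∀ {V} (T : SimpleGraph V) {a b c} → (∀ {z} → SimpleGraph.Adj T a z → b ≡ z) →
    a ≢ c → (w : Walk T a c) → b List.∈ vertices T w
  endpoint-neighbour∈ T uniq a≢c ε = contradiction refl a≢c
  endpoint-neighbour∈ T uniq a≢c (e ◅ w) with uniq e
  ... | refl = there (start∈vertices T w)

  endpoint⇒simplySeparated : ∀ C T → IsCliqueTree G T → Endpoint T C → SimplySeparated G C
  endpoint⇒simplySeparated C T ((connected , _) , between) (C′ , e , uniq) =
    exists-simp , C′ , sep⊆ , ⊆sep
    where
    C≢C′ : value C ≢ value C′
    C≢C′ eq = SimpleGraph.irrefl T (value-injective eq) e

    -- A simplicial vertex of `C` lies in no other maximal clique.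
    ⊆sep : ∀ {v} → v ∈ value C ∩ value C′ → Sep G C v
    ⊆sep v∈ =
      let v∈C , v∈C′ = x∈p∩q⁻ (value C) (value C′) v∈
      in v∈C , λ sv → C≢C′ (sym (simp-unique C (maximalIn C′) sv v∈C′))

    ¬simplicial⇒∈C′ : ∀ {v} → v ∈ value C → ¬ Simplicial G v → v ∈ value C′
    ¬simplicial⇒∈C′ v∈ ¬simp =
      let w , w∉ , vw = ¬simplicial⇒outer C v∈ ¬simp
          S , M , v∈S , w∈S = edge-clique vw
          D = maximalClique M
          -- Connectedness supplies a walk, whereas `between` speaks of paths.
          p , up = loopErase T (Refinement._≟_ _≟ₛ_) (connected C D)
          C≢D = λ eq → w∉ (subst (w ∈_) (sym (cong value eq)) w∈S)
      in between p up (endpoint-neighbour∈ T uniq C≢D p) (x∈p∩q⁺ (v∈ , v∈S))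

    sep⊆ : ∀ {v} → Sep G C v → v ∈ value C ∩ value C′
    sep⊆ (v∈ , ¬simp) = x∈p∩q⁺ (v∈ , ¬simplicial⇒∈C′ v∈ λ s → ¬simp (v∈ , s))

    -- Without simplicial vertices all of `C` would lie in `C′`, and maximality would make the two
    -- equal.
    exists-simp : ∃ (Simp G C)
    exists-simp with any? (simp? C)
    ... | yes found = found
    ... | no none = contradiction (maximal-≡ (maximalIn C) ⊆⊤ (clique (maximalIn C′))
                      λ v∈ → ¬simplicial⇒∈C′ v∈ λ s → none (_ , v∈ , s)) C≢C′

  -- The clique tree of an order

  module _ {Ls : List (Subset n)} (r : RunningIntersection Ls)
    (sound : ∀ {S} → S List.∈ Ls → MaximalIn full S)
    (complete : ∀ {S} → MaximalIn full S → S List.∈ Ls) where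

    cliqueTree : SimpleGraph (MaximalClique G)
    cliqueTree = record
      { Adj    = λ C D → TreeAdj r (value C) (value D)
      ; adj?   = λ C D → treeAdj? r (value C) (value D)
      ; sym    = treeAdj-sym r
      ; irrefl = λ eq → treeAdj-irrefl r (cong value eq)
      }

    -- Every set that the walk steps to is in `Ls`, so `sound` makes it a maximal clique. At the
    -- end, equality of the vertex sets suffices to identify it with `D`.
    lift-walk : ∀ {X Y} → Walk (tree r) X Y → ∀ C D → value C ≡ X → value D ≡ Y → Walk cliqueTree C D
    lift-walk ε C D refl eq with value-injective {v = D} {w = C} eq
    ... | refl = ε
    lift-walk (e ◅ w) C D refl eq = e ◅ lift-walk w (maximalClique (sound (treeAdj-∈ r e))) D refl eq

    lower-walk : ∀ {C D} → Walk cliqueTree C D → Walk (tree r) (value C) (value D)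
    lower-walk = Star.gmap value id

    vertices-lower : ∀ {C D} (w : Walk cliqueTree C D) →
      vertices (tree r) (lower-walk w) ≡ map value (vertices cliqueTree w)
    vertices-lower ε       = refl
    vertices-lower (_ ◅ w) = cong (_ ∷_) (vertices-lower w)

    member : ∀ C → value C List.∈ Ls
    member C = complete (maximalIn C)

    cliqueTree-isCliqueTree : IsCliqueTree G cliqueTree
    cliqueTree-isCliqueTree = (connected , acyclic) , between
      where
      connected : Connected cliqueTree
      connected C D = lift-walk (tree-walk r (member C) (member D)) C D refl refl
      acyclic : Acyclic cliqueTree
      acyclic c = tree-acyclic r record
        { 3≤k       = Cycle.3≤k c
        ; vertex    = value ∘ Cycle.vertex c
        ; injective = Cycle.injective c ∘ value-injective
        ; adjacent  = Cycle.adjacent c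
        }
      between : ∀ {C D} (p : Walk cliqueTree C D) → IsPath cliqueTree p →
        ∀ {E} → E List.∈ vertices cliqueTree p → value C ∩ value D ⊆ value E
      between {C} {D} p up E∈ v∈ =
        let v∈C , v∈D = x∈p∩q⁻ (value C) (value D) v∈
            eq = vertices-lower p
        in All.lookup
             (tree-path-∋ r (lower-walk p) (subst Unique (sym eq) (Unique.map⁺ value-injective up))
               (member C) (member D) v∈C v∈D)
             (subst (_ List.∈_) (sym eq) (∈-map⁺ value E∈))

  -- From a separator to an endpoint

  module FromSeparator (chordal : Chordal G) (C C′ : MaximalClique G) (exists-simp : ∃ (Simp G C))
    (sep⊆ : ∀ {v} → Sep G C v → v ∈ value C ∩ value C′)
    (⊆sep : ∀ {v} → v ∈ value C ∩ value C′ → Sep G C v) where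

    U : Subset n
    U = ⟦ ¬? ∘ simp? C ⟧

    ∈U⁻ : ∀ {x} → x ∈ U → ¬ Simp G C x
    ∈U⁻ = ∈-⟦⟧⁻ (¬? ∘ simp? C)

    ∈U⁺ : ∀ {x} → ¬ Simp G C x → x ∈ U
    ∈U⁺ = ∈-⟦⟧⁺ (¬? ∘ simp? C)

    C∩U⊆C′ : ∀ {x} → x ∈ value C → x ∈ U → x ∈ value C′
    C∩U⊆C′ x∈C x∈U = proj₂ (x∈p∩q⁻ (value C) (value C′) (sep⊆ (x∈C , ∈U⁻ x∈U)))

    C⊈U : ¬ value C ⊆ U
    C⊈U C⊆U = let v , sv = exists-simp in ∈U⁻ (C⊆U (proj₁ sv)) sv

    -- A vertex of `Simp C` in `C′` would lie in the intersection of `C` and `C′`, hence in `Sep C`.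
    C′⊆U : value C′ ⊆ U
    C′⊆U x∈C′ = ∈U⁺ λ sx → proj₂ (⊆sep (x∈p∩q⁺ (proj₁ sx , x∈C′))) sx

    restrict : ∀ {S} → MaximalIn full S → S ≢ value C → MaximalIn U S
    restrict M S≢C = record
      { inside  = λ x∈ → ∈U⁺ λ sx → S≢C (simp-unique C M sx x∈)
      ; clique  = clique M
      ; maximal = λ _ → maximal M ∈⊤
      }

    -- Outside `U` only a vertex `w` of `Simp C` could enlarge `S`. Then `S` lies in `C′` and so
    -- equals it, and the maximality of `C′` in the whole graph puts `w` into `S`.
    unrestrict : ∀ {S} → MaximalIn U S → MaximalIn full S
    unrestrict {S} M = record { inside = ⊆⊤ ; clique = clique M ; maximal = λ _ → max }
      where
      max : ∀ {w} → AdjAll w S → w ∈ S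
      max {w} a with simp? C w
      ... | no ¬sw = maximal M (∈U⁺ ¬sw) a
      ... | yes sw = subst (w ∈_) (sym S≡C′) w∈C′
        where
        -- S ∪ ⁅ w ⁆ is a clique through the simplicial vertex w of C.
        S⊆C′ : S ⊆ value C′
        S⊆C′ x∈ = C∩U⊆C′
          (simp-absorbs C sw (insert-clique (clique M) a) (y∈p∪⁅y⁆ {p = S}) (p⊆p∪q ⁅ w ⁆ x∈))
          (inside M x∈)
        S≡C′ : S ≡ value C′
        S≡C′ = maximal-≡ M C′⊆U (clique (maximalIn C′)) S⊆C′
        w∈C′ : w ∈ value C′
        w∈C′ = maximal (maximalIn C′) ∈⊤ (subst (AdjAll w) S≡C′ a)

    C′-maximal : MaximalIn U (value C′)
    C′-maximal = restrict (maximalIn C′) λ eq → C⊈U (subst (_⊆ U) eq C′⊆U)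

    -- Attached last, `C` has `C′` as its only tree neighbour. Separation holds because the older
    -- cliques lie in `U`, where `C` is contained in `C′`.
    endpointTree : CliqueOrder U → ∃ λ T → IsCliqueTree G T × Endpoint T C
    endpointTree (Ls , r , sound , complete) =
      cliqueTree r⁺ sound⁺ complete⁺ , cliqueTree-isCliqueTree r⁺ sound⁺ complete⁺ ,
      C′ , inj₂ (inj₁ (refl , refl)) , λ e → sym (value-injective (attach-leaf r C′∈ C∉ sep refl e))
      where
      C′∈ : value C′ List.∈ Ls
      C′∈ = complete C′-maximal
      C∉ : value C List.∉ Ls
      C∉ C∈ = C⊈U (inside (sound C∈))
      sep : ∀ {Q x} → Q List.∈ Ls → x ∈ value C → x ∈ Q → x ∈ value C′
      sep Q∈ x∈C x∈Q = C∩U⊆C′ x∈C (inside (sound Q∈) x∈Q)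
      r⁺ : RunningIntersection (value C ∷ Ls)
      r⁺ = attach r C′∈ C∉ sep
      sound⁺ : ∀ {S} → S List.∈ value C ∷ Ls → MaximalIn full S
      sound⁺ (here refl) = maximalIn C
      sound⁺ (there S∈)  = unrestrict (sound S∈)
      complete⁺ : ∀ {S} → MaximalIn full S → S List.∈ value C ∷ Ls
      complete⁺ {S} M with S ≟ₛ value C
      ... | yes S≡C = here S≡C
      ... | no S≢C  = there (complete (restrict M S≢C))

theorem3p2 : ∀ {n : ℕ} (G : SimpleGraph (Fin n)) → Connected G → Chordal G →
    (C : MaximalClique G) →
    (∃ λ (T : SimpleGraph (MaximalClique G)) → IsCliqueTree G T × Endpoint T C) ⇔ SimplySeparated G C
theorem3p2 G connected chordal C = mk⇔
  (λ (T , isCliqueTree , endpoint) → endpoint⇒simplySeparated G C T isCliqueTree endpoint)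
  (λ (exists-simp , C′ , sep⊆ , ⊆sep) →
    let open FromSeparator G chordal C C′ exists-simp sep⊆ ⊆sep in endpointTree (cliqueOrder G chordal U))
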